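{- Let $X$ be a non-empty finite set, let $(\mathcal{W}_X,\diamond)$ be the Cartesian magma generated by $X$ with norm $\|\cdot\|:\mathcal{W}_X\to\mathbb{N}$ given by $\|m\|=n$ when $m\in W_n(X)$, and put $p=|X|$. For $\ell\ge1$ let $$W_\ell=\{m\in\mathcal{W}_X:\|m\|=\ell\}.$$ Then $$|W_\ell|=|X|^{\ell}\,C_{\ell-1}=|X|^{\ell}\,\frac{1}{\ell}\binom{2\ell-2}{\ell-1}=C_{\ell-1}(p).$$
   Context: Here $\mathbb{N}=\{1,2,3,\dots\}$. For a non-empty finite set $X$ define recursively the sets of nested 2-tuples $$W_1(X)=X,\qquad W_n(X)=\bigcup_{q=1}^{n-1}W_q(X)\times W_{n-q}(X)\quad(n>1),\qquad \mathcal{W}_X=\bigcup_{n\ge1}W_n(X).$$ The elements of $X$ are regarded as atoms (no element of $X$ is an ordered pair of elements of $\mathcal{W}_X$), so that the sets $W_n(X)$ are pairwise disjoint. The product $\diamond:\mathcal{W}_X\times\mathcal{W}_X\to\mathcal{W}_X$ is $m_1\diamond m_2=(m_1,m_2)$; the symbol $\diamond$ merely denotes this product. The pair $(\mathcal{W}_X,\diamond)$ is called the Cartesian magma generated by $X$. The Catalan numbers are $C_n=\frac{1}{n+1}\binom{2n}{n}$ for $n\ge0$, and the $p$-Catalan numbers are $C_n(p)=p^{n+1}\frac{1}{n+1}\binom{2n}{n}$. -}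

module Defs where

open import Data.Integer using (+_)
open import Data.Nat using (ℕ; suc; _+_; _∸_; _^_; _≤_; _<_)
import Data.Nat as ℕ
open import Data.Nat.Combinatorics using (_C_)
open import Data.Nat.Properties using (≤-refl; ≤-trans; m≤m+n; m<m+n; m+n∸m≡n; m+[n∸m]≡n; <⇒≤)
open import Data.Product using (∃; Σ-syntax; _×_; _,_; proj₁; proj₂)
open import Data.Rational using (ℚ; _/_; _*_)
open import Level using (Level)
open import Relation.Binary.PropositionalEquality using (_≡_; refl; sym; trans; cong₂; subst)
open import Relation.Unary using (Pred; _∈_)

private
  variable
    a : Level
    X : Set a

infixr 5 _◇_

-- Nested 2-tuples over atoms from X: m₁ ◇ m₂ is the ordered pair (m₁ , m₂),
-- and being distinct constructors, atoms are never pairs.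
data 𝒲 (X : Set a) : Set a where
  atom : X → 𝒲 X
  _◇_  : 𝒲 X → 𝒲 X → 𝒲 X

-- The sets W_n(X) as subsets of 𝒲 X: W₁ = X, and for n > 1, W_n is the union
-- over 1 ≤ q ≤ n - 1 of W_q × W_{n-q}. (1 ≤ q < n forces n > 1.)
data W (X : Set a) : ℕ → Pred (𝒲 X) a where
  base : ∀ {x} → atom x ∈ W X 1
  step : ∀ {n q m₁ m₂} → 1 ≤ q → q < n →
         m₁ ∈ W X q → m₂ ∈ W X (n ∸ q) → m₁ ◇ m₂ ∈ W X n

-- 𝒲 X is the union of the W_n with n ≥ 1.
W-covers : (m : 𝒲 X) → ∃ λ n → 1 ≤ n × m ∈ W X n
W-covers (atom x) = 1 , ≤-refl , base
W-covers {X = X} (m₁ ◇ m₂) with W-covers m₁ | W-covers m₂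
... | q , 1≤q , m₁∈ | r , 1≤r , m₂∈ =
  q + r , ≤-trans 1≤q (m≤m+n q r) ,
  step 1≤q (m<m+n q 1≤r) m₁∈ (subst (λ k → m₂ ∈ W X k) (sym (m+n∸m≡n q r)) m₂∈)

‖_‖ : 𝒲 X → ℕ
‖ m ‖ = proj₁ (W-covers m)

‖‖-∈ : (m : 𝒲 X) → m ∈ W X ‖ m ‖
‖‖-∈ m = proj₂ (proj₂ (W-covers m))

-- The W_n are pairwise disjoint, so ‖ m ‖ is the only n with m ∈ W_n.
‖‖-unique : ∀ {n} {m : 𝒲 X} → m ∈ W X n → ‖ m ‖ ≡ n
‖‖-unique base = refl
‖‖-unique (step 1≤q q<n m₁∈ m₂∈) =
  trans (cong₂ _+_ (‖‖-unique m₁∈) (‖‖-unique m₂∈)) (m+[n∸m]≡n (<⇒≤ q<n))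

OfNorm : (X : Set a) → ℕ → Set a
OfNorm X ℓ = Σ[ m ∈ 𝒲 X ] ‖ m ‖ ≡ ℓ

fromℕ : ℕ → ℚ
fromℕ n = + n / 1

-- Rational-valued, so that the quotient by n + 1 is not truncated.
catalan : ℕ → ℚ
catalan n = (+ 1 / suc n) * fromℕ ((2 ℕ.* n) C n)

pCatalan : ℕ → ℕ → ℚ
pCatalan p n = fromℕ (p ^ (n + 1)) * (+ 1 / suc n) * fromℕ ((2 ℕ.* n) C n)

{-# OPTIONS --safe #-}

-- A forest of k trees with i pairs in total is either empty, or starts with an
-- atom, or starts with a pair s ◇ t; replacing s ◇ t by the two trees s, t gives
-- a forest of k + 1 trees with i - 1 pairs. The resulting linear recurrence is
-- that of the ballot numbers and is solved, by Pascal's rule alone, by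
--   ballot k i = (2i+k-1 choose i) - (2i+k-1 choose i-1).
-- Elements of norm n + 1 are the forests of one tree with n pairs, and
-- ballot 1 n = (2n choose n) - (2n choose n-1) is the Catalan number.
module Submission where

open import Defs
open import Data.Fin using (Fin; zero)
open import Data.Fin.Properties using (+↔⊎; *↔×)
open import Data.Integer using (+_)
import Data.Integer as ℤ
open import Data.Integer.Properties using (pos-*)
open import Data.Nat using (ℕ; zero; suc; NonZero; _+_; _∸_; _^_)
open import Data.Nat.Combinatorics using (_C_; nCk≡nC[n∸k]; nCk+nC[k+1]≡[n+1]C[k+1])
open import Data.Nat.Properties
  using (+-assoc; +-comm; +-suc; +-identityʳ; +-cancelʳ-≡; *-zeroʳ; suc-injective; ≡-irrelevant; m≤m+n; m+n∸m≡n)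
open import Data.Nat.Tactic.RingSolver using (solve-∀)
open import Data.Product using (∃; Σ-syntax; _×_; _,_)
open import Data.Product.Function.NonDependent.Propositional using (_×-↔_)
open import Data.Rational using (_/_; _*_; fromℚᵘ; toℚᵘ)
open import Data.Rational.Properties
  using (fromℚᵘ-toℚᵘ; fromℚᵘ-cong; toℚᵘ-homo-*; toℚᵘ-fromℚᵘ; *-assoc)
open import Data.Rational.Unnormalised using (mkℚᵘ; *≡*)
import Data.Rational.Unnormalised as ℚᵘ
import Data.Rational.Unnormalised.Properties as ℚᵘ
open import Data.Sum using (_⊎_; inj₁; inj₂)
open import Data.Sum.Function.Propositional using (_⊎-↔_)
open import Data.Vec using (Vec; []; _∷_)
open import Function.Bundles using (_↔_; mk↔ₛ′)
open import Function.Properties.Inverse using (↔-sym; ↔-trans)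
open import Level using (Level)
open import Relation.Binary.PropositionalEquality
  using (_≡_; refl; sym; trans; cong; cong₂; subst; module ≡-Reasoning)
import Data.Nat as ℕ

private
  variable
    a : Level
    X : Set a
    k i : ℕ

-- Forests of nested pairs and the recurrence for their number

pairs : 𝒲 X → ℕ
pairs (atom _) = 0
pairs (s ◇ t) = suc (pairs s + pairs t)

-- The norm counts leaves, and a binary tree has one leaf more than inner nodes.
‖‖≡1+pairs : (m : 𝒲 X) → ‖ m ‖ ≡ suc (pairs m)
‖‖≡1+pairs (atom _) = refl
‖‖≡1+pairs (s ◇ t) =
  trans (cong₂ _+_ (‖‖≡1+pairs s) (‖‖≡1+pairs t)) (cong suc (+-suc (pairs s) (pairs t)))

totalPairs : Vec (𝒲 X) k → ℕ
totalPairs [] = 0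
totalPairs (t ∷ ts) = pairs t + totalPairs ts

Forest : Set a → ℕ → ℕ → Set a
Forest X k i = Σ[ ts ∈ Vec (𝒲 X) k ] totalPairs ts ≡ i

-- The second component is an equation in `ℕ`, hence proof-irrelevant, so the bijections below need
-- only be checked on the trees.
forest-≡ : {ts us : Vec (𝒲 X) k} {p : totalPairs ts ≡ i} {q : totalPairs us ≡ i} →
           ts ≡ us → _≡_ {A = Forest X k i} (ts , p) (us , q)
forest-≡ {ts = ts} refl = cong (ts ,_) (≡-irrelevant _ _)

OfNorm↔Forest : ∀ n → OfNorm X (suc n) ↔ Forest X 1 n
OfNorm↔Forest {X = X} n = mk↔ₛ′ to from to∘from from∘to
  where
  to : OfNorm X (suc n) → Forest X 1 n
  to (m , eq) =
    m ∷ [] , trans (+-identityʳ (pairs m)) (suc-injective (trans (sym (‖‖≡1+pairs m)) eq))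

  from : Forest X 1 n → OfNorm X (suc n)
  from (m ∷ [] , eq) =
    m , trans (‖‖≡1+pairs m) (cong suc (trans (sym (+-identityʳ (pairs m))) eq))

  to∘from : ∀ f → to (from f) ≡ f
  to∘from (_ ∷ [] , _) = forest-≡ refl

  from∘to : ∀ m → from (to m) ≡ m
  from∘to (m , _) = cong (m ,_) (≡-irrelevant _ _)

forest-0-0 : Forest X 0 0 ↔ Fin 1
forest-0-0 = mk↔ₛ′ (λ _ → zero) (λ _ → [] , refl) (λ { zero → refl }) (λ { ([] , _) → forest-≡ refl })

forest-0-suc : Forest X 0 (suc i) ↔ Fin 0
forest-0-suc = mk↔ₛ′ (λ { ([] , ()) }) (λ ()) (λ ()) (λ { ([] , ()) })

forest-suc-0 : Forest X (suc k) 0 ↔ (X × Forest X k 0)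
forest-suc-0 = mk↔ₛ′
  (λ { (atom x ∷ ts , eq) → x , ts , eq })
  (λ { (x , ts , eq) → atom x ∷ ts , eq })
  (λ _ → refl)
  (λ { (atom _ ∷ _ , _) → refl })

forest-suc-suc : Forest X (suc k) (suc i) ↔ ((X × Forest X k (suc i)) ⊎ Forest X (2 + k) i)
forest-suc-suc {X = X} {k = k} {i = i} = mk↔ₛ′ to from to∘from from∘to
  where
  to : Forest X (suc k) (suc i) → (X × Forest X k (suc i)) ⊎ Forest X (2 + k) i
  to (atom x ∷ ts , eq) = inj₁ (x , ts , eq)
  to ((s ◇ t) ∷ ts , eq) =
    inj₂ (s ∷ t ∷ ts , trans (sym (+-assoc (pairs s) (pairs t) _)) (suc-injective eq))

  from : (X × Forest X k (suc i)) ⊎ Forest X (2 + k) i → Forest X (suc k) (suc i)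
  from (inj₁ (x , ts , eq)) = atom x ∷ ts , eq
  from (inj₂ (s ∷ t ∷ ts , eq)) =
    (s ◇ t) ∷ ts , cong suc (trans (+-assoc (pairs s) (pairs t) _) eq)

  to∘from : ∀ f → to (from f) ≡ f
  to∘from (inj₁ _) = refl
  to∘from (inj₂ (_ ∷ _ ∷ _ , _)) = cong inj₂ (forest-≡ refl)

  from∘to : ∀ f → from (to f) ≡ f
  from∘to (atom _ ∷ _ , _) = refl
  from∘to ((_ ◇ _) ∷ _ , _) = forest-≡ refl

-- Counts forest shapes, with the choice of atoms ignored. The recursion descends lexicographically:
-- either `i` drops, or `i` stays and `k` drops.
ballot : ℕ → ℕ → ℕ
ballot zero    zero    = 1
ballot zero    (suc i) = 0
ballot (suc k) zero    = ballot k 0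
ballot (suc k) (suc i) = ballot k (suc i) + ballot (2 + k) i

-- A forest of k trees with i pairs has k + i atoms.
Forest↔Fin : ∀ {p} → X ↔ Fin p → ∀ k i → Forest X k i ↔ Fin (p ^ (k + i) ℕ.* ballot k i)
Forest↔Fin X↔p zero zero = forest-0-0
Forest↔Fin {X = X} {p} X↔p zero (suc i) =
  subst (λ n → Forest X 0 (suc i) ↔ Fin n) (sym (*-zeroʳ (p ^ suc i))) forest-0-suc
Forest↔Fin {X = X} {p} X↔p (suc k) zero =
  subst (λ n → Forest X (suc k) 0 ↔ Fin n) (assoc p (p ^ (k + 0)) (ballot k 0))
    (↔-trans forest-suc-0 (↔-trans (X↔p ×-↔ Forest↔Fin X↔p k 0) (↔-sym *↔×)))
  where
  assoc : ∀ p q b → p ℕ.* (q ℕ.* b) ≡ p ℕ.* q ℕ.* b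
  assoc = solve-∀
Forest↔Fin {X = X} {p} X↔p (suc k) (suc i) =
  subst (λ n → Forest X (suc k) (suc i) ↔ Fin n) count
    (↔-trans forest-suc-suc
      (↔-trans (↔-trans (X↔p ×-↔ Forest↔Fin X↔p k (suc i)) (↔-sym *↔×) ⊎-↔ Forest↔Fin X↔p (2 + k) i)
        (↔-sym +↔⊎)))
  where
  distrib : ∀ p q b c → p ℕ.* (q ℕ.* b) + p ℕ.* q ℕ.* c ≡ p ℕ.* q ℕ.* (b + c)
  distrib = solve-∀

  -- Splitting a root pair keeps all atoms, so both summands carry the same power of `p`, which
  -- factors out.
  count : p ℕ.* (p ^ (k + suc i) ℕ.* ballot k (suc i)) + p ^ (2 + k + i) ℕ.* ballot (2 + k) i
          ≡ p ^ (suc k + suc i) ℕ.* ballot (suc k) (suc i)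
  count = trans
    (cong (λ e → p ℕ.* (p ^ (k + suc i) ℕ.* ballot k (suc i)) + p ^ suc e ℕ.* ballot (2 + k) i)
      (sym (+-suc k i)))
    (distrib p (p ^ (k + suc i)) (ballot k (suc i)) (ballot (2 + k) i))

-- Closed form of the ballot numbers

ballot-k-0 : ∀ k → ballot k 0 ≡ 1
ballot-k-0 zero = refl
ballot-k-0 (suc k) = ballot-k-0 k

-- The closed form at `suc i`, with the subtracted binomial moved to the left to stay in `ℕ`. For
-- `k = 0` it says that the two middle entries of row 2i+1 agree; otherwise Pascal's rule matches
-- the recurrence.
ballot-binomial : ∀ k i → ballot k (suc i) + suc (k + 2 ℕ.* i) C i ≡ suc (k + 2 ℕ.* i) C suc i
ballot-binomial zero i = subst (λ n → n C i ≡ n C suc i) (double i) (begin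
  (i + suc i) C i                ≡⟨ nCk≡nC[n∸k] (m≤m+n i (suc i)) ⟩
  (i + suc i) C (i + suc i ∸ i)  ≡⟨ cong ((i + suc i) C_) (m+n∸m≡n i (suc i)) ⟩
  (i + suc i) C suc i            ∎)
  where
  open ≡-Reasoning

  double : ∀ i → i + suc i ≡ suc (2 ℕ.* i)
  double = solve-∀
-- The second term of the recurrence has no pairs left, where no induction hypothesis applies; its
-- value 1 is put in directly.
ballot-binomial (suc k) zero = begin
  ballot k 1 + ballot k 0 + 1            ≡⟨ cong (λ b → ballot k 1 + b + 1) (ballot-k-0 k) ⟩
  ballot k 1 + 1 + 1                     ≡⟨ cong (_+ 1) (ballot-binomial k 0) ⟩
  suc (k + 0) C 1 + 1                    ≡⟨ +-comm (suc (k + 0) C 1) 1 ⟩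
  suc (k + 0) C 0 + suc (k + 0) C 1      ≡⟨ nCk+nC[k+1]≡[n+1]C[k+1] (suc (k + 0)) 0 ⟩
  suc (suc k + 0) C 1                    ∎
  where open ≡-Reasoning
ballot-binomial (suc k) (suc i) = begin
  b₁ + b₂ + suc n C suc i                ≡⟨ cong (_+_ (b₁ + b₂)) (nCk+nC[k+1]≡[n+1]C[k+1] n i) ⟨
  b₁ + b₂ + (n C i + n C suc i)          ≡⟨ exchange b₁ b₂ (n C i) (n C suc i) ⟩
  (b₂ + n C i) + (b₁ + n C suc i)        ≡⟨ cong₂ _+_ b₂-binomial (ballot-binomial k (suc i)) ⟩
  n C suc i + n C suc (suc i)            ≡⟨ nCk+nC[k+1]≡[n+1]C[k+1] n (suc i) ⟩
  suc n C suc (suc i)                    ∎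
  where
  open ≡-Reasoning

  n b₁ b₂ : ℕ
  n  = suc (k + 2 ℕ.* suc i)
  b₁ = ballot k (suc (suc i))
  b₂ = ballot (2 + k) (suc i)

  exchange : ∀ w x y z → w + x + (y + z) ≡ (x + y) + (w + z)
  exchange = solve-∀

  double-suc : ∀ k i → 3 + k + 2 ℕ.* i ≡ suc (k + 2 ℕ.* suc i)
  double-suc = solve-∀

  -- Trading one pair for two more trees leaves 2i+k fixed, so both induction hypotheses live in the
  -- same row `n`.
  b₂-binomial : b₂ + n C i ≡ n C suc i
  b₂-binomial = subst (λ m → b₂ + m C i ≡ m C suc i) (double-suc k i) (ballot-binomial (2 + k) i)

-- From ballot numbers to Catalan numbers

-- (k + 1) (n choose k + 1) = (n - k) (n choose k), without subtraction.
absorption : ∀ n k → suc k ℕ.* (n C suc k) + k ℕ.* (n C k) ≡ n ℕ.* (n C k)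
absorption zero zero = refl
absorption zero (suc k) = cong₂ _+_ (*-zeroʳ (2 + k)) (*-zeroʳ (suc k))
absorption (suc n) zero = begin
  1 ℕ.* (suc n C 1) + 0        ≡⟨ cong (λ c → 1 ℕ.* c + 0) (nCk+nC[k+1]≡[n+1]C[k+1] n 0) ⟨
  1 ℕ.* (1 + n C 1) + 0        ≡⟨ expand (n C 1) ⟩
  1 + (1 ℕ.* (n C 1) + 0)      ≡⟨ cong suc (absorption n 0) ⟩
  suc n ℕ.* (suc n C 0)        ∎
  where
  open ≡-Reasoning

  expand : ∀ c → 1 ℕ.* (1 + c) + 0 ≡ 1 + (1 ℕ.* c + 0)
  expand = solve-∀
absorption (suc n) (suc k) = begin
  (2 + k) ℕ.* (suc n C (2 + k)) + suc k ℕ.* (suc n C suc k)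
    ≡⟨ cong₂ (λ c d → (2 + k) ℕ.* c + suc k ℕ.* d) pascal₂ pascal₁ ⟨
  (2 + k) ℕ.* (c₁ + c₂) + suc k ℕ.* (c₀ + c₁)
    -- Regrouped into the left sides of the induction hypotheses at `suc k` and `k`; the leftover
    -- `c₀ + c₁` raises the factor `n` to `suc n`.
    ≡⟨ collect k c₀ c₁ c₂ ⟩
  ((2 + k) ℕ.* c₂ + suc k ℕ.* c₁) + (suc k ℕ.* c₁ + k ℕ.* c₀) + (c₀ + c₁)
    ≡⟨ cong₂ (λ x y → x + y + (c₀ + c₁)) (absorption n (suc k)) (absorption n k) ⟩
  n ℕ.* c₁ + n ℕ.* c₀ + (c₀ + c₁)
    ≡⟨ factor n c₀ c₁ ⟩
  suc n ℕ.* (c₀ + c₁)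
    ≡⟨ cong (suc n ℕ.*_) pascal₁ ⟩
  suc n ℕ.* (suc n C suc k) ∎
  where
  open ≡-Reasoning

  c₀ c₁ c₂ : ℕ
  c₀ = n C k
  c₁ = n C suc k
  c₂ = n C (2 + k)

  pascal₁ : c₀ + c₁ ≡ suc n C suc k
  pascal₁ = nCk+nC[k+1]≡[n+1]C[k+1] n k

  pascal₂ : c₁ + c₂ ≡ suc n C (2 + k)
  pascal₂ = nCk+nC[k+1]≡[n+1]C[k+1] n (suc k)

  collect : ∀ k x y z → (2 + k) ℕ.* (y + z) + suc k ℕ.* (x + y)
            ≡ ((2 + k) ℕ.* z + suc k ℕ.* y) + (suc k ℕ.* y + k ℕ.* x) + (x + y)
  collect = solve-∀

  factor : ∀ n x y → n ℕ.* y + n ℕ.* x + (x + y) ≡ suc n ℕ.* (x + y)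
  factor = solve-∀

-- For `n = m + 1`, the closed form gives b = c′ - c and absorption gives (m+1)c′ = (m+2)c, so
-- (m+2)b = (m+2)c′ - (m+1)c′ = c′.
[1+n]*ballot≡central : ∀ n → suc n ℕ.* ballot 1 n ≡ (2 ℕ.* n) C n
[1+n]*ballot≡central zero = refl
[1+n]*ballot≡central (suc m) = trans
  -- The added term is (2m+2)c in two pieces: (m+2)c completes `b` to `c′`, and mc is what
  -- absorption consumes.
  (+-cancelʳ-≡ (m ℕ.* c + (2 + m) ℕ.* c) _ _ (begin
    (2 + m) ℕ.* b + (m ℕ.* c + (2 + m) ℕ.* c)    ≡⟨ collect m b c ⟩
    (2 + m) ℕ.* (b + c) + m ℕ.* c                ≡⟨ cong (λ x → (2 + m) ℕ.* x + m ℕ.* c) (ballot-binomial 1 m) ⟩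
    (2 + m) ℕ.* c′ + m ℕ.* c                     ≡⟨ +-assoc c′ (suc m ℕ.* c′) (m ℕ.* c) ⟩
    c′ + (suc m ℕ.* c′ + m ℕ.* c)                ≡⟨ cong (_+_ c′) (absorption n m) ⟩
    c′ + n ℕ.* c                                 ≡⟨ cong (_+_ c′) (split m c) ⟩
    c′ + (m ℕ.* c + (2 + m) ℕ.* c)               ∎))
  (cong (_C suc m) (double-suc m))
  where
  open ≡-Reasoning

  n b c c′ : ℕ
  n  = 2 + 2 ℕ.* m
  b  = ballot 1 (suc m)
  c  = n C m
  c′ = n C suc m

  collect : ∀ m b c → (2 + m) ℕ.* b + (m ℕ.* c + (2 + m) ℕ.* c) ≡ (2 + m) ℕ.* (b + c) + m ℕ.* c
  collect = solve-∀

  split : ∀ m c → (2 + 2 ℕ.* m) ℕ.* c ≡ m ℕ.* c + (2 + m) ℕ.* c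
  split = solve-∀

  double-suc : ∀ m → 2 + 2 ℕ.* m ≡ 2 ℕ.* suc m
  double-suc = solve-∀

-- Passage to the rationals

fromℚᵘ-homo-* : ∀ p q → fromℚᵘ (p ℚᵘ.* q) ≡ fromℚᵘ p * fromℚᵘ q
fromℚᵘ-homo-* p q = trans
  (fromℚᵘ-cong (ℚᵘ.≃-sym (ℚᵘ.≃-trans
    (toℚᵘ-homo-* (fromℚᵘ p) (fromℚᵘ q))
    (ℚᵘ.*-cong (toℚᵘ-fromℚᵘ p) (toℚᵘ-fromℚᵘ q)))))
  (fromℚᵘ-toℚᵘ (fromℚᵘ p * fromℚᵘ q))

fromℕ-homo-* : ∀ m n → fromℕ (m ℕ.* n) ≡ fromℕ m * fromℕ n
fromℕ-homo-* m n =
  trans (cong (_/ 1) (pos-* m n)) (fromℚᵘ-homo-* (mkℚᵘ (+ m) 0) (mkℚᵘ (+ n) 0))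

-- Cross-multiplication, done on unnormalised fractions, where equality is an integer equation and
-- no gcd intervenes.
fromℕ-quotient : ∀ {b c} n → suc n ℕ.* b ≡ c → fromℕ b ≡ (+ 1 / suc n) * fromℕ c
fromℕ-quotient {b} n refl = trans
  (fromℚᵘ-cong {mkℚᵘ (+ b) 0} {mkℚᵘ (+ 1) n ℚᵘ.* mkℚᵘ (+ (suc n ℕ.* b)) 0} (*≡* (begin
    + b ℤ.* + (suc n ℕ.* 1)                  ≡⟨ pos-* b (suc n ℕ.* 1) ⟨
    + (b ℕ.* (suc n ℕ.* 1))                  ≡⟨ cong +_ (swap n b) ⟩
    + (1 ℕ.* (suc n ℕ.* b) ℕ.* 1)            ≡⟨ pos-* (1 ℕ.* (suc n ℕ.* b)) 1 ⟩
    + (1 ℕ.* (suc n ℕ.* b)) ℤ.* + 1          ≡⟨ cong (ℤ._* + 1) (pos-* 1 (suc n ℕ.* b)) ⟩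
    + 1 ℤ.* + (suc n ℕ.* b) ℤ.* + 1          ∎)))
  (fromℚᵘ-homo-* (mkℚᵘ (+ 1) n) (mkℚᵘ (+ (suc n ℕ.* b)) 0))
  where
  open ≡-Reasoning

  swap : ∀ n b → b ℕ.* (suc n ℕ.* 1) ≡ 1 ℕ.* (suc n ℕ.* b) ℕ.* 1
  swap = solve-∀

proposition2 : ∀ {a} (X : Set a) → X → (p : ℕ) → X ↔ Fin p →
    (ℓ : ℕ) .{{_ : NonZero ℓ}} →
    ∃ λ (N : ℕ) →
    (OfNorm X ℓ ↔ Fin N) ×
    (fromℕ N ≡ fromℕ (p ^ ℓ) * catalan (ℓ ∸ 1)) ×
    (fromℕ (p ^ ℓ) * catalan (ℓ ∸ 1) ≡ fromℕ (p ^ ℓ) * (+ 1 / ℓ) * fromℕ ((2 ℕ.* ℓ ∸ 2) C (ℓ ∸ 1))) ×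
    (fromℕ (p ^ ℓ) * (+ 1 / ℓ) * fromℕ ((2 ℕ.* ℓ ∸ 2) C (ℓ ∸ 1)) ≡ pCatalan p (ℓ ∸ 1))
proposition2 X _ p X↔p (suc n) =
  -- One tree with `n` pairs has `suc n` atoms: labellings times shapes.
  p ^ suc n ℕ.* ballot 1 n ,
  ↔-trans (OfNorm↔Forest n) (Forest↔Fin X↔p 1 n) ,
  trans (fromℕ-homo-* (p ^ suc n) (ballot 1 n))
    (cong (fromℕ (p ^ suc n) *_) (fromℕ-quotient n ([1+n]*ballot≡central n))) ,
  trans (sym (*-assoc (fromℕ (p ^ suc n)) (+ 1 / suc n) _))
    (cong (λ m → fromℕ (p ^ suc n) * (+ 1 / suc n) * fromℕ (m C n)) (sym 2[1+n]∸2≡2n)) ,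
  cong₂ (λ e m → fromℕ (p ^ e) * (+ 1 / suc n) * fromℕ (m C n)) (+-comm 1 n) 2[1+n]∸2≡2n
  where
  2[1+n]∸2≡2n : 2 ℕ.* suc n ∸ 2 ≡ 2 ℕ.* n
  -- The left side computes to `(n + suc (n + 0)) ∸ 1`.
  2[1+n]∸2≡2n = cong (_∸ 1) (+-suc n (n + 0))
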